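{- Let $\mathit{Exp}$ be the set of conditional expressions over a set $A$ of symbols, $\mathit{Exp}_\bot$ the corresponding flat domain, and let $norm:\mathit{Exp}_\bot\to\mathit{Exp}_\bot$ be a continuous (equivalently, monotone) function satisfying, for all $a\in A$ and all $u,v,w,y,z\in\mathit{Exp}$, $$norm(At(a))=At(a),$$ $$norm(\mathit{If}(At(a),y,z))=\mathit{If}(At(a),norm(y),norm(z)),$$ $$norm(\mathit{If}(\mathit{If}(u,v,w),y,z))=norm(\mathit{If}(u,\mathit{If}(v,y,z),\mathit{If}(w,y,z))).$$ Let $norm_1$ be the structurally recursive function defined in the context. Then $norm(x)=norm_1(x)$ for every $x\in\mathit{Exp}$.
   Context: Fix a set $A$ of symbols. The set $\mathit{Exp}$ of conditional expressions is the inductive type freely generated by the constructors $At(a)$ for $a\in A$ and $\mathit{If}(x,y,z)$ for $x,y,z\in\mathit{Exp}$. The flat domain $\mathit{Exp}_\bot=\mathit{Exp}\cup\{\bot\}$ adds one undefined element $\bot$, ordered by $p\sqsubseteq q$ iff $p=\bot$ or $p=q$; $\mathit{If}$ is extended strictly to $\mathit{Exp}_\bot$, so $\mathit{If}(x,y,z)=\bot$ if any of $x,y,z$ is $\bot$. The elements of $\mathit{Exp}$ are the defined elements. The function $normif:\mathit{Exp}\times\mathit{Exp}\times\mathit{Exp}\to\mathit{Exp}$ is defined by structural recursion on its first argument (for all values of the second and third): $$normif(At(a),y,z)=\mathit{If}(At(a),y,z),$$ $$normif(\mathit{If}(u,v,w),y,z)=normif(u,\,normif(v,y,z),\,normif(w,y,z)).$$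 The function $norm_1:\mathit{Exp}\to\mathit{Exp}$ is defined by structural recursion: $$norm_1(At(a))=At(a),\qquad norm_1(\mathit{If}(x,y,z))=normif(x,norm_1(y),norm_1(z)).$$ -}

module Defs where

open import Data.Sum.Base using (_⊎_)
open import Relation.Binary.Core using (Rel)
open import Relation.Binary.PropositionalEquality.Core using (_≡_)
open import Relation.Nullary.Construct.Add.Infimum using (_₋; ⊥₋; [_])

data Exp {a} (A : Set a) : Set a where
  At : A → Exp A
  If : Exp A → Exp A → Exp A → Exp A

-- The flat domain over Exp A: ⊥₋ is the undefined element and [ x ] is the
-- expression x viewed as a defined element.
Exp⊥ : ∀ {a} → Set a → Set a
Exp⊥ A = Exp A ₋

infix 4 _⊑_

_⊑_ : ∀ {a} {A : Set a} → Rel (Exp⊥ A) a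
p ⊑ q = p ≡ ⊥₋ ⊎ p ≡ q

-- The strict extension of If to the flat domain.
If⊥ : ∀ {a} {A : Set a} → Exp⊥ A → Exp⊥ A → Exp⊥ A → Exp⊥ A
If⊥ [ x ] [ y ] [ z ] = [ If x y z ]
If⊥ [ x ] [ y ] ⊥₋    = ⊥₋
If⊥ [ x ] ⊥₋    r     = ⊥₋
If⊥ ⊥₋    q     r     = ⊥₋

normif : ∀ {a} {A : Set a} → Exp A → Exp A → Exp A → Exp A
normif (At a)     y z = If (At a) y z
normif (If u v w) y z = normif u (normif v y z) (normif w y z)

norm₁ : ∀ {a} {A : Set a} → Exp A → Exp A
norm₁ (At a)     = At a
norm₁ (If x y z) = normif x (norm₁ y) (norm₁ z)

{-# OPTIONS --safe #-}
-- The third equation enlarges its argument, so the induction is not on the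
-- argument of norm.  Instead, fix the values of norm on the branches y and z
-- and compute norm (If x y z) by structural induction on the condition x, for
-- all y and z at once: when x = If u v w, the hypotheses for v and w supply the
-- values on the new branches If v y z and If w y z required for u.
module Submission where

open import Defs
open import Relation.Binary.Definitions using (Monotonic₁)
open import Relation.Binary.PropositionalEquality using (_≡_; trans; cong₂)
open import Relation.Nullary.Construct.Add.Infimum using ([_])

module _ {ℓ} {A : Set ℓ} (norm : Exp⊥ A → Exp⊥ A)
  (norm-If-At : ∀ (a : A) (y z : Exp A) →
    norm [ If (At a) y z ] ≡ If⊥ [ At a ] (norm [ y ]) (norm [ z ]))
  (norm-If-If : ∀ (u v w y z : Exp A) →
    norm [ If (If u v w) y z ] ≡ norm [ If u (If v y z) (If w y z) ])
  where

  -- The premises also say that `norm` is defined on the branches, so definedness is proved along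
  -- with the value.
  norm-If : ∀ (x : Exp A) {y z y′ z′ : Exp A} →
    norm [ y ] ≡ [ y′ ] → norm [ z ] ≡ [ z′ ] →
    norm [ If x y z ] ≡ [ normif x y′ z′ ]
  norm-If (At a) {y} {z} y↦y′ z↦z′ =
    -- On defined branch values `If⊥` reduces to the first clause of `normif`.
    trans (norm-If-At a y z) (cong₂ (If⊥ [ At a ]) y↦y′ z↦z′)
  norm-If (If u v w) {y} {z} y↦y′ z↦z′ =
    trans (norm-If-If u v w y z)
          -- The new branches have values `normif v y′ z′` and `normif w y′ z′`, as in the second
          -- clause of `normif`.
          (norm-If u (norm-If v y↦y′ z↦z′) (norm-If w y↦y′ z↦z′))

mainTheorem3 : ∀ {ℓ} (A : Set ℓ) (norm : Exp⊥ A → Exp⊥ A) →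
    Monotonic₁ _⊑_ _⊑_ norm →
    (∀ (a : A) → norm [ At a ] ≡ [ At a ]) →
    (∀ (a : A) (y z : Exp A) →
    norm [ If (At a) y z ] ≡ If⊥ [ At a ] (norm [ y ]) (norm [ z ])) →
    (∀ (u v w y z : Exp A) →
    norm [ If (If u v w) y z ] ≡ norm [ If u (If v y z) (If w y z) ]) →
    ∀ (x : Exp A) → norm [ x ] ≡ [ norm₁ x ]
mainTheorem3 A norm mono norm-At norm-If-At norm-If-If = norm≡norm₁
  where
  norm≡norm₁ : ∀ (x : Exp A) → norm [ x ] ≡ [ norm₁ x ]
  norm≡norm₁ (At a)     = norm-At a
  norm≡norm₁ (If x y z) =
    -- Induction is needed on the branches only; `norm-If` takes care of the condition `x`.
    norm-If norm norm-If-At norm-If-If x (norm≡norm₁ y) (norm≡norm₁ z)
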